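{- Let $\varphi$ be a formula and let $\bigvee_{k\in K}\delta_k$ be a disjunctive normal form of $\varphi$ in K45. For each $S\subseteq K$, let $B_S$ and $\Gamma_S$ be the sets of formulas $\beta$ and $\gamma$, respectively, such that $\Box\beta$, respectively $\Diamond\gamma$, occurs as a conjunct in $\bigwedge_{k\in S}\delta_k^{\Box\Diamond}$. Then, for each of the classes of frames $\mathcal{K}=$ KD45 and $\mathcal{K}=$ S5, the following are equivalent (all semantic notions being relative to $\mathcal{K}$): \begin{enumerate} \item[1.] $\varphi$ is unbelievable. \item[2.] $\varphi$ is unknowable. \item[3.] $\varphi\leftrightarrow(\varphi\land\lnot\Box\varphi)$ is valid. \item[4.] For any $S\subseteq K$, (i) $B_S\cup\{\bigvee_{k\in S}\delta_k^{\alpha}\}$ is unsatisfiable, or (ii) there exists a $\gamma\in\Gamma_S$ such that $B_S\cup\{\bigvee_{k\in S}\delta_k^{\alpha}\}\cup\{\gamma\}$ is unsatisfiable. \end{enumerate} Moreover, in S5 the following conditions 5 and 6 are also equivalent to each of conditions 1, 2, 3 and 4 (taken with $\mathcal{K}=$ S5): \begin{enumerate} \item[5.] $\varphi$ is always informative. \item[6.] $\varphi$ is eventually self-refuting. \end{enumerate}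
   Context: Formulas (single agent) are built from a set $\mathbf{Prop}$ of proposition letters by $\varphi:=p\mid\lnot\varphi\mid\varphi\land\psi\mid\Box\varphi$; other connectives and $\Diamond=\lnot\Box\lnot$ are abbreviations. Kripke models $M=(W,R,V)$ and truth $M,w\models\varphi$ are standard. KD45 is the class of frames with serial, transitive, Euclidean $R$; S5 is the class of frames with $R$ an equivalence relation; K45 is the class of frames with transitive, Euclidean $R$. A formula or set of formulas is satisfiable in a class of frames if it is (jointly) true at some state of some model based on a frame in the class; valid means true at all states of all such models. $\varphi$ is believable in $\mathcal{K}$ iff $\Box\varphi$ is satisfiable in $\mathcal{K}$, and knowable in $\mathcal{K}$ iff $\varphi\land\Box\varphi$ is satisfiable in $\mathcal{K}$. Unbelievable means not believable, and unknowable means not knowable. A disjunctive normal form in K45 is a (finite) disjunction $\bigvee_{k\in K}\delta_k$ of conjunctions of the form $\delta\equiv\alpha\land\Box\beta_1\land\cdots\land\Box\beta_n\land\Diamond\gamma_1\land\cdots\land\Diamond\gamma_m$, where $\alpha$ and each $\gamma_j$ are conjunctions of literals and each $\beta_j$ is a disjunction of literals; it is a disjunctive normal form of $\varphi$ if it is logically equivalent to $\varphi$ in K45. For such $\delta$, write $\delta^\alpha\equiv\alpha$ and $\delta^{\Box\Diamond}\equiv\Box\beta_1\land\cdots\land\Box\beta_n\land\Diamond\gamma_1\land\cdots\land\Diamond\gamma_m$. Empty disjunctions are $\bot$ and empty conjunctions are $\top$. The relativization of $M=(W,R,V)$ to $\varphi$ is the submodel $M_{|\varphi}=(W_{|\varphi},R_{|\varphi},V_{|\varphi})$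 with $W_{|\varphi}=\{w\in W: M,w\models\varphi\}$, $R_{|\varphi}=R\cap(W_{|\varphi}\times W_{|\varphi})$, $V_{|\varphi}(p)=V(p)\cap W_{|\varphi}$. Put $M_{|^0\varphi}=M$ and $M_{|^{n+1}\varphi}=(M_{|^n\varphi})_{|\varphi}$. In S5, where pointed models range over S5 pointed models: $\varphi$ is always informative iff for all pointed models with $M,w\models\varphi$, $M_{|\varphi}\neq M$; $\varphi$ is eventually self-refuting iff for all pointed models, if $M,w\models\varphi$ then there is an $n$ such that $M_{|^n\varphi},w\not\models\varphi$ (with $N,w\not\models\varphi$ by convention if $w$ is not a state of $N$). -}

module Defs where

open import Level using (Level; 0ℓ) renaming (suc to lsuc)
open import Data.Nat.Base using (ℕ; zero; suc)
open import Data.Fin.Base using (Fin)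
open import Data.Fin.Subset using (Subset) renaming (_∈_ to _∈ˢ_)
open import Data.Fin.Subset.Properties using (_∈?_)
open import Data.List.Base using (List; []; _∷_; _++_; map; filter; foldr; allFin)
open import Data.List.Membership.Propositional using () renaming (_∈_ to _∈ˡ_)
open import Data.List.Relation.Unary.AllPairs using (AllPairs)
open import Data.Product.Base using (Σ; _×_; ∃; ∃-syntax)
open import Data.Sum.Base using (_⊎_)
open import Function.Bundles using (_⇔_)
open import Relation.Binary.Core using (Rel; _⇒_)
open import Relation.Binary.Definitions using (Symmetric; Transitive)
open import Relation.Nullary.Negation.Core using (¬_)
open import Relation.Unary using (Pred; _∈_; _∉_; _⊆_; _∪_; _∩_; _≐_; ｛_｝)

TFAE : ∀ {ℓ} → List (Set ℓ) → Set (lsuc ℓ)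
TFAE = AllPairs _⇔_

-- A frame lives on a set W of states inside an ambient type U.  As in set
-- theory, the states of a submodel are then literally states of the model:
-- one can speak of a state of M not being a state of a submodel, and a model
-- can be compared with its submodels.

record Frame (U : Set) : Set₁ where
  field
    W   : Pred U 0ℓ
    R   : Rel U 0ℓ
    R⊆W : ∀ {x y} → R x y → x ∈ W × y ∈ W

FrameClass : Set₁
FrameClass = ∀ {U : Set} → Frame U → Set

-- Since R relates only elements of W, transitivity, symmetry and the
-- Euclidean property need no restriction to W; seriality and reflexivity do.

Serial : FrameClass
Serial F = ∀ {x} → x ∈ W → ∃[ y ] R x y
  where open Frame F

Reflexive-on-W : FrameClass
Reflexive-on-W F = ∀ {x} → x ∈ W → R x x
  where open Frame F

Euclidean : FrameClass
Euclidean F = ∀ {x y z} → R x y → R x z → R y z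
  where open Frame F

K45 : FrameClass
K45 F = Transitive (Frame.R F) × Euclidean F

KD45 : FrameClass
KD45 F = Serial F × Transitive (Frame.R F) × Euclidean F

S5 : FrameClass
S5 F = Reflexive-on-W F × Symmetric (Frame.R F) × Transitive (Frame.R F)

-- At is the set of proposition letters.  The grammar has no formulas at all
-- when At is empty; the letter p₀ serves only to express the abbreviation ⊥
-- (and hence ⊤), and any letter will do.

module Modal (At : Set) (p₀ : At) where

  infix  9 ¬ᶠ_ □_ ◇_
  infixr 7 _∧_
  infixr 6 _∨_
  infixr 5 _⊃_
  infix  4 _↔_

  data Formula : Set where
    var : At → Formula
    ¬ᶠ_ : Formula → Formula
    _∧_ : Formula → Formula → Formula
    □_  : Formula → Formula

  ◇_ : Formula → Formula
  ◇ φ = ¬ᶠ □ ¬ᶠ φ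

  _∨_ _⊃_ _↔_ : Formula → Formula → Formula
  φ ∨ ψ = ¬ᶠ (¬ᶠ φ ∧ ¬ᶠ ψ)
  φ ⊃ ψ = ¬ᶠ φ ∨ ψ
  φ ↔ ψ = (φ ⊃ ψ) ∧ (ψ ⊃ φ)

  ⊥ᶠ ⊤ᶠ : Formula
  ⊥ᶠ = var p₀ ∧ ¬ᶠ var p₀
  ⊤ᶠ = ¬ᶠ ⊥ᶠ

  ⋀ ⋁ : List Formula → Formula
  ⋀ = foldr _∧_ ⊤ᶠ
  ⋁ = foldr _∨_ ⊥ᶠ

  record Model (U : Set) : Set₁ where
    field
      frame : Frame U
    open Frame frame public
    field
      V   : At → Pred U 0ℓ
      V⊆W : ∀ p → V p ⊆ W

  open Model using (frame)

  -- Truth is of interest only at elements of W; every use below is guarded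
  -- accordingly.

  infix 3 _,_⊨_

  _,_⊨_ : ∀ {U} → Model U → U → Formula → Set
  M , w ⊨ var p   = w ∈ Model.V M p
  M , w ⊨ ¬ᶠ φ    = ¬ (M , w ⊨ φ)
  M , w ⊨ (φ ∧ ψ) = (M , w ⊨ φ) × (M , w ⊨ ψ)
  M , w ⊨ □ φ     = ∀ v → Model.R M w v → M , v ⊨ φ

  Satisfiable : FrameClass → Pred Formula 0ℓ → Set₁
  Satisfiable 𝒦 Γ =
    Σ Set λ U → Σ (Model U) λ M → 𝒦 (frame M) ×
      ∃[ w ] w ∈ Model.W M × (∀ ψ → ψ ∈ Γ → M , w ⊨ ψ)

  Valid : FrameClass → Formula → Set₁
  Valid 𝒦 φ =
    ∀ {U : Set} (M : Model U) → 𝒦 (frame M) → ∀ w → w ∈ Model.W M → M , w ⊨ φ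

  Believable Knowable Unbelievable Unknowable : FrameClass → Formula → Set₁
  Believable   𝒦 φ = Satisfiable 𝒦 ｛ □ φ ｝
  Knowable     𝒦 φ = Satisfiable 𝒦 ｛ φ ∧ □ φ ｝
  Unbelievable 𝒦 φ = ¬ Believable 𝒦 φ
  Unknowable   𝒦 φ = ¬ Knowable 𝒦 φ

  data Literal : Set where
    pos neg : At → Literal

  ⌜_⌝ : Literal → Formula
  ⌜ pos p ⌝ = var p
  ⌜ neg p ⌝ = ¬ᶠ var p

  litConj litDisj : List Literal → Formula
  litConj ls = ⋀ (map ⌜_⌝ ls)
  litDisj ls = ⋁ (map ⌜_⌝ ls)

  record Disjunct : Set where
    field
      αs : List Literal
      βs : List (List Literal)
      γs : List (List Literal)

    α : Formula
    α = litConj αs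

    boxed diamonded : List Formula
    boxed     = map litDisj βs
    diamonded = map litConj γs

    □◇ : Formula
    □◇ = ⋀ (map □_ boxed ++ map ◇_ diamonded)

    formula : Formula
    formula = α ∧ □◇

  -- The index set K is Fin n.

  IsDNFOf : ∀ {n} → (Fin n → Disjunct) → Formula → Set₁
  IsDNFOf {n} δ φ =
    Valid K45 (φ ↔ ⋁ (map (λ k → Disjunct.formula (δ k)) (allFin n)))

  module _ {n} (δ : Fin n → Disjunct) (S : Subset n) where

    B Γ : Pred Formula 0ℓ
    B ψ = ∃[ k ] k ∈ˢ S × ψ ∈ˡ Disjunct.boxed (δ k)
    Γ ψ = ∃[ k ] k ∈ˢ S × ψ ∈ˡ Disjunct.diamonded (δ k)

    ⋁α : Formula
    ⋁α = ⋁ (map (λ k → Disjunct.α (δ k)) (filter (_∈? S) (allFin n)))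

  DNFCondition : FrameClass → ∀ {n} → (Fin n → Disjunct) → Set₁
  DNFCondition 𝒦 {n} δ = (S : Subset n) →
    (¬ Satisfiable 𝒦 (B δ S ∪ ｛ ⋁α δ S ｝)) ⊎
    (∃[ γ ] γ ∈ Γ δ S × ¬ Satisfiable 𝒦 (B δ S ∪ ｛ ⋁α δ S ｝ ∪ ｛ γ ｝))

  infix  4 _≈ᴹ_
  infixl 8 _∣_ _∣^[_]_

  -- Set-theoretic equality of models: the same states, relation and valuation.

  _≈ᴹ_ : ∀ {U} → Model U → Model U → Set
  M ≈ᴹ N = (M.W ≐ N.W) × (M.R ⇒ N.R) × (N.R ⇒ M.R) × (∀ p → M.V p ≐ N.V p)
    where module M = Model M
          module N = Model N

  _∣_ : ∀ {U} → Model U → Formula → Model U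
  M ∣ φ = record
    { frame = record
      { W   = W′
      ; R   = λ x y → R x y × (x ∈ W′ × y ∈ W′)
      ; R⊆W = Σ.proj₂
      }
    ; V   = λ p → V p ∩ W′
    ; V⊆W = λ p → Σ.proj₂
    }
    where
    open Model M
    W′ : Pred _ 0ℓ
    W′ w = w ∈ W × (M , w ⊨ φ)

  _∣^[_]_ : ∀ {U} → Model U → ℕ → Formula → Model U
  M ∣^[ zero  ] φ = M
  M ∣^[ suc n ] φ = (M ∣^[ n ] φ) ∣ φ

  AlwaysInformative : Formula → Set₁
  AlwaysInformative φ =
    ∀ {U : Set} (M : Model U) → S5 (frame M) → ∀ w → w ∈ Model.W M →
    M , w ⊨ φ → ¬ (M ∣ φ ≈ᴹ M)

  -- A formula counts as not true at a non-state.

  EventuallySelfRefuting : Formula → Set₁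
  EventuallySelfRefuting φ =
    ∀ {U : Set} (M : Model U) → S5 (frame M) → ∀ w → w ∈ Model.W M →
    M , w ⊨ φ →
    ∃[ n ] ¬ (w ∈ Model.W (M ∣^[ n ] φ) × (M ∣^[ n ] φ , w ⊨ φ))

{-# OPTIONS --safe #-}
module Submission where

-- Each condition is equivalent to φ not being global, where φ is called global
-- if it is true at all states of some nonempty S5 model.  Throughout, 𝒦 lies between S5 and KD45, which covers
-- both classes at once.
--
-- * A global φ is knowable in S5, hence in 𝒦, and knowable formulas are
--   believable.
--
-- * Suppose □ φ is true at w in a model of 𝒦.  Let S be the set of indices of
--   the disjuncts true at some state accessible from w.  By transitivity and
--   the Euclidean property, states accessible from w see exactly the states
--   that w sees.  So each of these makes B_S and the disjunction of the α's
--   true, and each γ in Γ_S is true at one of them; by seriality there is at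
--   least one.  Thus S violates the normal form condition
--   (believable⇒coherent).
--
-- * Conversely, if S violates that condition, then all formulas involved being
--   propositional, they can be evaluated at valuations.  In the model of all
--   valuations satisfying B_S and the disjunction of the α's, any two states
--   being related, each state satisfies some α with index in S, and the boxes
--   and diamonds of all disjuncts with index in S.  So φ is true throughout
--   this S5 model (coherent⇒global).
--
-- * A model restricts to itself under φ exactly if φ is true throughout it.
--   This settles being always informative, and shows that no global formula is
--   eventually self-refuting, since all iterates then equal the model.
--
-- * Suppose w survives, with φ true at it, in all iterates of an S5 model.
--   Boxes of propositional formulas persist under relativization; diamonds may
--   get lost, but are never regained.  As there are finitely many disjuncts,
--   from some stage N on no disjunct whose diamonds are all true at w loses one
--   of them (stabilise).  So each disjunct true at a state accessible from w is
--   still true there at the next stage, if the state survives.  The states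
--   remaining at stage N + 1 are those where φ is true at stage N, so □ φ is
--   true at w at stage N + 1 (surviving⇒believable).  Hence φ is believable in
--   S5, and so global.

open import Defs
open import Level using (Lift; lift; lower; 0ℓ) renaming (suc to lsuc)
open import Axiom.ExcludedMiddle using (ExcludedMiddle)
open import Data.Bool.Base using (Bool; true)
open import Data.Nat.Base using (ℕ; zero; suc; _≤_; _⊔_; _≤′_; ≤′-refl; ≤′-step)
open import Data.Nat.Properties using (≤-refl; ≤-trans; m≤m⊔n; m≤n⊔m; ≤⇒≤′)
open import Data.Fin.Base using (Fin; zero; suc)
open import Data.Fin.Subset using (Subset) renaming (_∈_ to _∈ˢ_)
open import Data.Fin.Subset.Properties using (_∈?_)
open import Data.List.Base using (List; []; _∷_; map; filter; allFin)
open import Data.List.Membership.Propositional using () renaming (_∈_ to _∈ˡ_)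
open import Data.List.Membership.Propositional.Properties
  using (∈-map⁺; ∈-map⁻; ∈-++⁺ˡ; ∈-++⁺ʳ; ∈-++⁻; ∈-filter⁺; ∈-filter⁻; ∈-allFin)
open import Data.List.Relation.Unary.All as All using (All; []; _∷_)
open import Data.List.Relation.Unary.All.Properties using (++⁺)
open import Data.List.Relation.Unary.AllPairs using ([]; _∷_)
open import Data.List.Relation.Unary.Any using (here; there)
open import Data.Product.Base using (Σ; _×_; _,_; proj₁; proj₂; ∃-syntax)
open import Data.Product.Function.NonDependent.Propositional using (_×-⇔_)
open import Data.Sum.Base using (_⊎_; inj₁; inj₂)
open import Data.Vec.Base using (tabulate; lookup)
open import Data.Vec.Properties using (lookup∘tabulate; []=⇒lookup; lookup⇒[]=)
open import Function.Base using (_∘_; id)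
open import Function.Bundles using (_⇔_; mk⇔; Equivalence)
open import Function.Construct.Composition using (_⇔-∘_)
open import Function.Construct.Symmetry using (⇔-sym)
open import Relation.Binary.Definitions using (Symmetric; Transitive)
open import Relation.Binary.PropositionalEquality using (_≡_; refl; trans; sym)
open import Relation.Nullary.Decidable using (Dec; yes; no; does; map′; decidable-stable)
open import Relation.Nullary.Negation using (¬_; contraposition; contradiction)
open import Relation.Unary using (Pred; _∈_; _⊆_; _∪_; U; ｛_｝)

open Equivalence using (to; from)

TFAE-via : ∀ {ℓ} {X : Set ℓ} {Ps : List (Set ℓ)} → All (X ⇔_) Ps → TFAE Ps
TFAE-via []       = []
TFAE-via (e ∷ es) = All.map (λ f → f ⇔-∘ ⇔-sym e) es ∷ TFAE-via es

¬-⇔ : ∀ {a b} {A : Set a} {B : Set b} → A ⇔ B → (¬ A) ⇔ (¬ B)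
¬-⇔ e = mk⇔ (contraposition (from e)) (contraposition (to e))

does-true : ∀ {P : Set} (P? : Dec P) → (does P? ≡ true) ⇔ P
does-true (yes p) = mk⇔ (λ _ → p) (λ _ → refl)
does-true (no ¬p) = mk⇔ (λ ()) (λ p → contradiction p ¬p)

-- Classical logic

module Classical (em : ExcludedMiddle (lsuc 0ℓ)) where

  dec : (P : Set) → Dec P
  dec P = map′ lower lift (em {Lift (lsuc 0ℓ) P})

  dne : {P : Set} → ¬ ¬ P → P
  dne = decidable-stable (dec _)

  dne₁ : {P : Set₁} → ¬ ¬ P → P
  dne₁ = decidable-stable em

  comprehension : ∀ {n} (P : Pred (Fin n) 0ℓ) → ∃[ S ] (∀ k → (k ∈ˢ S) ⇔ P k)
  comprehension {n} P = S , λ k → mk⇔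
    (λ k∈S → to (does-true (dec (P k))) (trans (sym (S-at k)) ([]=⇒lookup k∈S)))
    (λ Pk → lookup⇒[]= k S (trans (S-at k) (from (does-true (dec (P k))) Pk)))
    where
    S : Subset n
    S = tabulate (λ k → does (dec (P k)))

    S-at : ∀ k → lookup S k ≡ does (dec (P k))
    S-at = lookup∘tabulate (λ k → does (dec (P k)))

  Decreasing : Pred ℕ 0ℓ → Set
  Decreasing Q = ∀ m → Q (suc m) → Q m

  decreasing-≤ : ∀ {Q} → Decreasing Q → ∀ {l m} → l ≤ m → Q m → Q l
  decreasing-≤ {Q} ↓ = go ∘ ≤⇒≤′
    where
    go : ∀ {l m} → l ≤′ m → Q m → Q l
    go ≤′-refl       q = q
    go (≤′-step l≤m) q = go l≤m (↓ _ q)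

  -- Finitely many decreasing predicates on ℕ are simultaneously constant from
  -- some point on: each of them either holds everywhere, or fails from its
  -- first failure onwards.
  stabilise : ∀ {n} (Q : Fin n → Pred ℕ 0ℓ) → (∀ k → Decreasing (Q k)) →
    ∃[ N ] (∀ m → N ≤ m → ∀ k → Q k m → Q k (suc m))
  stabilise {zero}  Q ↓ = 0 , λ _ _ ()
  stabilise {suc n} Q ↓
    with stabilise (Q ∘ suc) (↓ ∘ suc) | dec (∃[ m ] ¬ Q zero m)
  ... | N , stable | no always = N , λ
    { m N≤m zero    _ → dne (λ ¬q → always (suc m , ¬q))
    ; m N≤m (suc k) q → stable m N≤m k q }
  ... | N , stable | yes (N₀ , fails) = N₀ ⊔ N , λ
    { m ≤m zero    q → contradiction
        (decreasing-≤ {Q zero} (↓ zero) (≤-trans (m≤m⊔n N₀ N) ≤m) q) fails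
    ; m ≤m (suc k) q → stable m (≤-trans (m≤n⊔m N₀ N) ≤m) k q }

-- Frame classes

-- Inclusion of frame classes.
infix 4 _⊑_

_⊑_ : FrameClass → FrameClass → Set₁
𝒦 ⊑ ℒ = ∀ {V : Set} (F : Frame V) → 𝒦 F → ℒ F

S5⊑S5 : S5 ⊑ S5
S5⊑S5 _ = id

KD45⊑KD45 : KD45 ⊑ KD45
KD45⊑KD45 _ = id

KD45⊑K45 : KD45 ⊑ K45
KD45⊑K45 _ = proj₂

S5⊑KD45 : S5 ⊑ KD45
S5⊑KD45 _ (rfl , symm , tran) =
  (λ {x} x∈W → x , rfl x∈W) , tran , λ xRy xRz → tran (symm xRy) xRz

module Semantics (em : ExcludedMiddle (lsuc 0ℓ)) (At : Set) (p₀ : At) where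

  open Classical em
  open Modal At p₀
  open Model using (W; R; R⊆W; V; frame)

-- Truth of the derived connectives

  module _ {X : Set} (M : Model X) (w : X) where

    ⊨-⊃ : ∀ φ ψ → (M , w ⊨ φ ⊃ ψ) ⇔ ((M , w ⊨ φ) → (M , w ⊨ ψ))
    ⊨-⊃ φ ψ = mk⇔
      (λ h p → dne (λ ¬q → h ((λ ¬p → ¬p p) , ¬q)))
      (λ f (¬¬p , ¬q) → ¬¬p (¬q ∘ f))

    ⊨-↔ : ∀ φ ψ → (M , w ⊨ φ ↔ ψ) ⇔ ((M , w ⊨ φ) ⇔ (M , w ⊨ ψ))
    ⊨-↔ φ ψ = mk⇔
      (λ (f , g) → mk⇔ (to (⊨-⊃ φ ψ) f) (to (⊨-⊃ ψ φ) g))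
      (λ e → from (⊨-⊃ φ ψ) (to e) , from (⊨-⊃ ψ φ) (from e))

    ⊨-◇ : ∀ φ → (M , w ⊨ ◇ φ) ⇔ (∃[ v ] R M w v × (M , v ⊨ φ))
    ⊨-◇ φ = mk⇔
      (λ h → dne (λ none → h (λ v wRv p → none (v , wRv , p))))
      (λ (v , wRv , p) h → h v wRv p)

    ⊨-⋀ : ∀ φs → (M , w ⊨ ⋀ φs) ⇔ (∀ φ → φ ∈ˡ φs → M , w ⊨ φ)
    ⊨-⋀ []       = mk⇔ (λ _ _ ()) (λ _ (p , ¬p) → ¬p p)
    ⊨-⋀ (φ ∷ φs) = mk⇔
      (λ { (p , _)  ψ (here refl) → p
         ; (_ , ps) ψ (there ψ∈)  → to (⊨-⋀ φs) ps ψ ψ∈ })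
      (λ h → h φ (here refl) , from (⊨-⋀ φs) (λ ψ → h ψ ∘ there))

    ⊨-⋁ : ∀ φs → (M , w ⊨ ⋁ φs) ⇔ (∃[ φ ] φ ∈ˡ φs × (M , w ⊨ φ))
    ⊨-⋁ []       = mk⇔ (λ (p , ¬p) → contradiction p ¬p) (λ { (_ , () , _) })
    ⊨-⋁ (φ ∷ φs) = mk⇔
      (λ h → dne (λ none → h
        ( (λ p → none (φ , here refl , p))
        , (λ ps → let (ψ , ψ∈ , q) = to (⊨-⋁ φs) ps in none (ψ , there ψ∈ , q)))))
      (λ { (_ , here refl , p) (¬p , _)  → ¬p p
         ; (ψ , there ψ∈ , q)  (_ , ¬ps) → ¬ps (from (⊨-⋁ φs) (ψ , ψ∈ , q)) })

-- Propositional formulas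

  -- Formulas without boxes.
  data Propositional : Pred Formula 0ℓ where
    var : ∀ p → Propositional (var p)
    ¬ᶠ_ : ∀ {φ} → Propositional φ → Propositional (¬ᶠ φ)
    _∧_ : ∀ {φ ψ} → Propositional φ → Propositional ψ → Propositional (φ ∧ ψ)

  -- The truth of a propositional formula depends only on the letters true at
  -- the state.
  ⊨-propositional : ∀ {X Y : Set} (M : Model X) (N : Model Y) {v w} →
    (∀ p → (v ∈ V M p) ⇔ (w ∈ V N p)) →
    ∀ {φ} → Propositional φ → (M , v ⊨ φ) ⇔ (N , w ⊨ φ)
  ⊨-propositional M N e (var p) = e p
  ⊨-propositional M N e (¬ᶠ φ)  = ¬-⇔ (⊨-propositional M N e φ)
  ⊨-propositional M N e (φ ∧ ψ) =
    ⊨-propositional M N e φ ×-⇔ ⊨-propositional M N e ψ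

  literal-propositional : ∀ l → Propositional ⌜ l ⌝
  literal-propositional (pos p) = var p
  literal-propositional (neg p) = ¬ᶠ var p

  ⊥-propositional : Propositional ⊥ᶠ
  ⊥-propositional = var p₀ ∧ (¬ᶠ var p₀)

  ⋁-propositional : ∀ {A : Set} {f : A → Formula} → (∀ x → Propositional (f x)) →
    ∀ xs → Propositional (⋁ (map f xs))
  ⋁-propositional f-prop []       = ⊥-propositional
  ⋁-propositional f-prop (x ∷ xs) =
    ¬ᶠ ((¬ᶠ f-prop x) ∧ (¬ᶠ ⋁-propositional f-prop xs))

  litDisj-propositional : ∀ ls → Propositional (litDisj ls)
  litDisj-propositional = ⋁-propositional literal-propositional

  litConj-propositional : ∀ ls → Propositional (litConj ls)
  litConj-propositional []       = ¬ᶠ ⊥-propositional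
  litConj-propositional (l ∷ ls) = literal-propositional l ∧ litConj-propositional ls

  module _ (d : Disjunct) where
    open Disjunct d

    boxed-propositional : ∀ {β} → β ∈ˡ boxed → Propositional β
    boxed-propositional β∈ with ∈-map⁻ litDisj β∈
    ... | ls , _ , refl = litDisj-propositional ls

    diamonded-propositional : ∀ {γ} → γ ∈ˡ diamonded → Propositional γ
    diamonded-propositional γ∈ with ∈-map⁻ litConj γ∈
    ... | ls , _ , refl = litConj-propositional ls

-- Total models on sets of valuations

  -- The model whose states are the valuations in X, any two of them related,
  -- each state making exactly its own letters true.
  total : Pred (At → Bool) 0ℓ → Model (At → Bool)
  total X = record
    { frame = record
      { W   = X
      ; R   = λ v w → v ∈ X × w ∈ X
      ; R⊆W = id
      }
    ; V   = λ p v → v p ≡ true × v ∈ X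
    ; V⊆W = λ p → proj₂
    }

  total-S5 : ∀ X → S5 (frame (total X))
  total-S5 X =
    (λ x → x , x) , (λ (x , y) → y , x) , (λ (x , _) (_ , z) → x , z)

  infix 3 _⊩_

  -- Classical truth of a propositional formula under a valuation.
  _⊩_ : (At → Bool) → Formula → Set
  v ⊩ φ = total U , v ⊨ φ

  ⊨-total : ∀ {X v φ} → v ∈ X → Propositional φ → (total X , v ⊨ φ) ⇔ (v ⊩ φ)
  ⊨-total v∈X = ⊨-propositional (total _) (total U)
    (λ p → mk⇔ (λ (vp , _) → vp , _) (λ (vp , _) → vp , v∈X))

  -- Propositional formulas that are jointly true at a state of a model are so
  -- under the valuation read off that state.
  satisfying-valuation : ∀ {𝒦 : FrameClass} {Φ} → Φ ⊆ Propositional → Satisfiable 𝒦 Φ →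
    ∃[ v ] (∀ φ → φ ∈ Φ → v ⊩ φ)
  satisfying-valuation {𝒦} {Φ} Φ-prop (_ , M , _ , w , _ , sat) =
    v , λ φ φ∈ → to (⊨-propositional M (total U) agree (Φ-prop φ∈)) (sat φ φ∈)
    where
    v : At → Bool
    v p = does (dec (w ∈ V M p))

    agree : ∀ p → (w ∈ V M p) ⇔ (v ∈ V (total U) p)
    agree p = mk⇔
      (λ wp → from (does-true (dec (w ∈ V M p))) wp , _)
      (λ (vp , _) → to (does-true (dec (w ∈ V M p))) vp)

-- Disjuncts of a normal form

  -- The modal part of d, read off a set X of accessible states: the formulas
  -- under a box hold throughout X, those under a diamond somewhere in X.
  Realises : ∀ {Y : Set} → Model Y → Pred Y 0ℓ → Disjunct → Set
  Realises M X d =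
    (∀ β → β ∈ˡ Disjunct.boxed d → ∀ v → v ∈ X → M , v ⊨ β) ×
    (∀ γ → γ ∈ˡ Disjunct.diamonded d → ∃[ v ] v ∈ X × (M , v ⊨ γ))

  ⊨-□◇ : ∀ {Y : Set} (M : Model Y) w d →
    (M , w ⊨ Disjunct.□◇ d) ⇔ Realises M (R M w) d
  ⊨-□◇ M w d = mk⇔
    (λ h → let all = to (⊨-⋀ M w _) h in
        (λ β β∈ → all (□ β) (∈-++⁺ˡ (∈-map⁺ □_ β∈)))
      , (λ γ γ∈ → to (⊨-◇ M w γ)
           (all (◇ γ) (∈-++⁺ʳ (map □_ boxed) (∈-map⁺ ◇_ γ∈)))))
    (λ (bs , cs) → from (⊨-⋀ M w _) (λ ψ ψ∈ → conjunct bs cs (∈-++⁻ (map □_ boxed) ψ∈)))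
    where
    open Disjunct d

    conjunct : (∀ β → β ∈ˡ boxed → M , w ⊨ □ β) →
      (∀ γ → γ ∈ˡ diamonded → ∃[ v ] R M w v × (M , v ⊨ γ)) →
      ∀ {ψ} → (ψ ∈ˡ map □_ boxed) ⊎ (ψ ∈ˡ map ◇_ diamonded) → M , w ⊨ ψ
    conjunct bs cs (inj₁ ψ∈) with ∈-map⁻ □_ ψ∈
    ... | β , β∈ , refl = bs β β∈
    conjunct bs cs (inj₂ ψ∈) with ∈-map⁻ ◇_ ψ∈
    ... | γ , γ∈ , refl = from (⊨-◇ M w γ) (cs γ γ∈)

  module _ {n} (δ : Fin n → Disjunct) where

    δα : Fin n → Formula
    δα k = Disjunct.α (δ k)

    δα-propositional : ∀ k → Propositional (δα k)
    δα-propositional k = litConj-propositional (Disjunct.αs (δ k))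

    disjuncts : List Formula
    disjuncts = map (Disjunct.formula ∘ δ) (allFin n)

    ⊨-disjunct : ∀ {Y : Set} (M : Model Y) w →
      (M , w ⊨ ⋁ disjuncts) ⇔
      (∃[ k ] (M , w ⊨ δα k) × Realises M (R M w) (δ k))
    ⊨-disjunct M w = mk⇔ ⇒ ⇐
      where
      ⇒ : M , w ⊨ ⋁ disjuncts →
        ∃[ k ] (M , w ⊨ δα k) × Realises M (R M w) (δ k)
      ⇒ h with to (⊨-⋁ M w disjuncts) h
      ... | _ , ψ∈ , t with ∈-map⁻ (Disjunct.formula ∘ δ) ψ∈
      ...   | k , _ , refl = k , proj₁ t , to (⊨-□◇ M w (δ k)) (proj₂ t)

      ⇐ : (∃[ k ] (M , w ⊨ δα k) × Realises M (R M w) (δ k)) →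
        M , w ⊨ ⋁ disjuncts
      ⇐ (k , a , r) = from (⊨-⋁ M w disjuncts)
        ( Disjunct.formula (δ k)
        , ∈-map⁺ (Disjunct.formula ∘ δ) (∈-allFin k)
        , a , from (⊨-□◇ M w (δ k)) r)

    module _ (S : Subset n) where

      ⊨-⋁α : ∀ {Y : Set} (M : Model Y) w →
        (M , w ⊨ ⋁α δ S) ⇔ (∃[ k ] k ∈ˢ S × (M , w ⊨ δα k))
      ⊨-⋁α M w = mk⇔ ⇒ ⇐
        where
        ⇒ : M , w ⊨ ⋁α δ S → ∃[ k ] k ∈ˢ S × (M , w ⊨ δα k)
        ⇒ h with to (⊨-⋁ M w (map δα (filter (_∈? S) (allFin n)))) h
        ... | _ , ψ∈ , t with ∈-map⁻ δα ψ∈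
        ...   | k , k∈ , refl = k , proj₂ (∈-filter⁻ (_∈? S) {xs = allFin n} k∈) , t

        ⇐ : (∃[ k ] k ∈ˢ S × (M , w ⊨ δα k)) → M , w ⊨ ⋁α δ S
        ⇐ (k , k∈S , a) = from (⊨-⋁ M w (map δα (filter (_∈? S) (allFin n))))
          (δα k , ∈-map⁺ δα (∈-filter⁺ (_∈? S) (∈-allFin k) k∈S) , a)

      -- The formulas that the condition on S requires to be jointly
      -- satisfiable, with and without one of the γ's.
      Core : Pred Formula 0ℓ
      Core = B δ S ∪ ｛ ⋁α δ S ｝

      Core-propositional : Core ⊆ Propositional
      Core-propositional (inj₁ (k , _ , β∈)) = boxed-propositional (δ k) β∈
      Core-propositional (inj₂ refl) =
        ⋁-propositional δα-propositional (filter (_∈? S) (allFin n))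

      -- Failure of the condition that DNFCondition imposes on S.
      Coherent : FrameClass → Set₁
      Coherent 𝒦 = Satisfiable 𝒦 (B δ S ∪ ｛ ⋁α δ S ｝) ×
        (∀ γ → γ ∈ Γ δ S → Satisfiable 𝒦 (B δ S ∪ ｛ ⋁α δ S ｝ ∪ ｛ γ ｝))

    incoherent⇔DNFCondition : ∀ {𝒦 : FrameClass} →
      (¬ (∃[ S ] Coherent S 𝒦)) ⇔ DNFCondition 𝒦 δ
    incoherent⇔DNFCondition {𝒦} = mk⇔ ⇒ ⇐
      where
      ⇒ : ¬ (∃[ S ] Coherent S 𝒦) → DNFCondition 𝒦 δ
      ⇒ none S with em {Satisfiable 𝒦 (B δ S ∪ ｛ ⋁α δ S ｝)}
      ... | no ¬sat = inj₁ ¬sat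
      ... | yes sat = inj₂ (dne₁ (λ ¬γ → none (S , sat ,
        λ γ γ∈ → dne₁ (λ ¬sat → ¬γ (γ , γ∈ , ¬sat)))))

      ⇐ : DNFCondition 𝒦 δ → ¬ (∃[ S ] Coherent S 𝒦)
      ⇐ cond (S , sat , sats) with cond S
      ... | inj₁ ¬sat            = ¬sat sat
      ... | inj₂ (γ , γ∈ , ¬sat) = ¬sat (sats γ γ∈)

-- Formulas true throughout an S5 model

  TrueThroughout : ∀ {Y : Set} → Model Y → Formula → Set
  TrueThroughout M φ = ∀ w → w ∈ W M → M , w ⊨ φ

  -- φ is true at all states of some nonempty S5 model.
  Global : Formula → Set₁
  Global φ = Σ Set λ Y → Σ (Model Y) λ M → S5 (frame M) ×
    (∃[ w ] w ∈ W M) × TrueThroughout M φ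

  unknowable⇔valid : ∀ (𝒦 : FrameClass) φ → Unknowable 𝒦 φ ⇔ Valid 𝒦 (φ ↔ φ ∧ ¬ᶠ □ φ)
  unknowable⇔valid 𝒦 φ = mk⇔
    (λ unk {_} M k w w∈ → from (⊨-↔ M w φ (φ ∧ ¬ᶠ □ φ)) (mk⇔
      (λ p → p , λ □p → unk (_ , M , k , w , w∈ , λ { _ refl → p , □p }))
      proj₁))
    (λ { valid (_ , M , k , w , w∈ , t) →
      let (p , □p) = t _ refl in
      proj₂ (to (to (⊨-↔ M w φ (φ ∧ ¬ᶠ □ φ)) (valid M k w w∈)) p) □p })

  module _ {𝒦 : FrameClass} (φ : Formula) where

    global⇒knowable : S5 ⊑ 𝒦 → Global φ → Knowable 𝒦 φ
    global⇒knowable S5⊑𝒦 (Y , M , s5 , (w , w∈) , t) =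
      Y , M , S5⊑𝒦 (frame M) s5 , w , w∈ , λ
        { _ refl → t w w∈ , λ v wRv → t v (proj₂ (R⊆W M wRv)) }

    knowable⇒believable : Knowable 𝒦 φ → Believable 𝒦 φ
    knowable⇒believable (Y , M , k , w , w∈ , t) =
      Y , M , k , w , w∈ , λ { _ refl → proj₂ (t _ refl) }

-- Relativization

  ≈ᴹ-trans : ∀ {Y : Set} {L M N : Model Y} → L ≈ᴹ M → M ≈ᴹ N → L ≈ᴹ N
  ≈ᴹ-trans ((w₁ , w₂) , r₁ , r₂ , v) ((w₃ , w₄) , r₃ , r₄ , v′) =
    (w₃ ∘ w₁ , w₂ ∘ w₄) , r₃ ∘ r₁ , r₂ ∘ r₄ ,
    λ p → proj₁ (v′ p) ∘ proj₁ (v p) , proj₂ (v p) ∘ proj₂ (v′ p)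

  ⊨-resp-≈ᴹ : ∀ {Y : Set} {M N : Model Y} → M ≈ᴹ N → ∀ φ {w} →
    (M , w ⊨ φ) ⇔ (N , w ⊨ φ)
  ⊨-resp-≈ᴹ (_ , _ , _ , v) (var p) = mk⇔ (proj₁ (v p)) (proj₂ (v p))
  ⊨-resp-≈ᴹ e (¬ᶠ φ)  = ¬-⇔ (⊨-resp-≈ᴹ e φ)
  ⊨-resp-≈ᴹ e (φ ∧ ψ) = ⊨-resp-≈ᴹ e φ ×-⇔ ⊨-resp-≈ᴹ e ψ
  ⊨-resp-≈ᴹ e@(_ , r₁ , r₂ , _) (□ φ) = mk⇔
    (λ h v wRv → to (⊨-resp-≈ᴹ e φ) (h v (r₂ wRv)))
    (λ h v wRv → from (⊨-resp-≈ᴹ e φ) (h v (r₁ wRv)))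

  ∣-trivial : ∀ {Y : Set} (M : Model Y) φ → TrueThroughout M φ → M ∣ φ ≈ᴹ M
  ∣-trivial M φ t =
      (proj₁ , λ w∈ → w∈ , t _ w∈)
    , proj₁
    , (λ xRy → let (x∈ , y∈) = R⊆W M xRy in xRy , (x∈ , t _ x∈) , (y∈ , t _ y∈))
    , λ p → proj₁ , λ wp → let w∈ = Model.V⊆W M p wp in wp , w∈ , t _ w∈

  ∣^-trivial : ∀ {Y : Set} (M : Model Y) φ → TrueThroughout M φ → ∀ m → M ∣^[ m ] φ ≈ᴹ M
  ∣^-trivial M φ t zero    = (id , id) , id , id , λ _ → id , id
  ∣^-trivial M φ t (suc m) =
    ≈ᴹ-trans {L = M ∣^[ suc m ] φ} {M = M ∣^[ m ] φ} {N = M}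
      (∣-trivial (M ∣^[ m ] φ) φ t′) e
    where
    e : M ∣^[ m ] φ ≈ᴹ M
    e = ∣^-trivial M φ t m

    t′ : TrueThroughout (M ∣^[ m ] φ) φ
    t′ w w∈ = from (⊨-resp-≈ᴹ {M = M ∣^[ m ] φ} {N = M} e φ) (t w (proj₁ (proj₁ e) w∈))

  ∣-S5 : ∀ {Y : Set} (M : Model Y) φ → S5 (frame M) → S5 (frame (M ∣ φ))
  ∣-S5 M φ (rfl , symm , tran) =
      (λ w∈ → rfl (proj₁ w∈) , w∈ , w∈)
    , (λ (xRy , x∈ , y∈) → symm xRy , y∈ , x∈)
    , (λ (xRy , x∈ , _) (yRz , _ , z∈) → tran xRy yRz , x∈ , z∈)

  ∣^-S5 : ∀ {Y : Set} (M : Model Y) φ → S5 (frame M) → ∀ m → S5 (frame (M ∣^[ m ] φ))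
  ∣^-S5 M φ s5 zero    = s5
  ∣^-S5 M φ s5 (suc m) = ∣-S5 (M ∣^[ m ] φ) φ (∣^-S5 M φ s5 m)

  ⊨-∣ : ∀ {Y : Set} (M : Model Y) φ {w} → w ∈ W (M ∣ φ) →
    ∀ {ψ} → Propositional ψ → (M ∣ φ , w ⊨ ψ) ⇔ (M , w ⊨ ψ)
  ⊨-∣ M φ w∈ = ⊨-propositional (M ∣ φ) M (λ p → mk⇔ proj₁ (λ wp → wp , w∈))

  alwaysInformative⇔ : ∀ φ → (¬ Global φ) ⇔ AlwaysInformative φ
  alwaysInformative⇔ φ = mk⇔
    (λ ¬glob {_} M s5 w w∈ _ ((_ , W⊆) , _) →
      ¬glob (_ , M , s5 , (w , w∈) , λ v v∈ → proj₂ (W⊆ v∈)))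
    (λ inf (_ , M , s5 , (w , w∈) , t) →
      inf M s5 w w∈ (t w w∈) (∣-trivial M φ t))

  selfRefuting⇒¬global : ∀ φ → EventuallySelfRefuting φ → ¬ Global φ
  selfRefuting⇒¬global φ esr (_ , M , s5 , (w , w∈) , t)
    with esr M s5 w w∈ (t w w∈)
  ... | m , ¬w =
    ¬w (proj₂ (proj₁ e) w∈ , from (⊨-resp-≈ᴹ {M = M ∣^[ m ] φ} {N = M} e φ) (t w w∈))
    where
    e : M ∣^[ m ] φ ≈ᴹ M
    e = ∣^-trivial M φ t m

-- Consequences of a normal form

  module DNF (φ : Formula) {n} (δ : Fin n → Disjunct) (dnf : IsDNFOf δ φ) where

    ⊨-φ : ∀ {Y : Set} (M : Model Y) → K45 (frame M) → ∀ w → w ∈ W M →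
      (M , w ⊨ φ) ⇔ (∃[ k ] (M , w ⊨ δα δ k) × Realises M (R M w) (δ k))
    ⊨-φ M k45 w w∈ =
      ⊨-disjunct δ M w ⇔-∘ to (⊨-↔ M w φ (⋁ (disjuncts δ))) (dnf M k45 w w∈)

    -- The witness consists of the disjuncts true at states accessible from a
    -- state where □ φ is true.
    believable⇒coherent : ∀ {𝒦 : FrameClass} → 𝒦 ⊑ KD45 → Believable 𝒦 φ →
      ∃[ S ] Coherent δ S 𝒦
    believable⇒coherent {𝒦} 𝒦⊑KD45 (Y , M , k , w , w∈ , t)
      with 𝒦⊑KD45 (frame M) k
    ... | serial , tran , eucl =
      S
      , (let (u , wRu) = serial w∈ in
          Y , M , k , u , proj₂ (R⊆W M wRu) , λ _ → core wRu)
      , diamond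
      where
      -- The disjunct δ k is true at some state accessible from w.
      Somewhere : Pred (Fin n) 0ℓ
      Somewhere k =
        ∃[ u ] R M w u × (M , u ⊨ δα δ k) × Realises M (R M u) (δ k)

      S : Subset n
      S = proj₁ (comprehension Somewhere)

      S⇔ : ∀ k → (k ∈ˢ S) ⇔ Somewhere k
      S⇔ = proj₂ (comprehension Somewhere)

      core : ∀ {u} → R M w u → ∀ {ψ} → ψ ∈ Core δ S → M , u ⊨ ψ
      core wRu (inj₁ (k , k∈S , β∈)) with to (S⇔ k) k∈S
      ... | u′ , wRu′ , _ , boxes , _ = boxes _ β∈ _ (eucl wRu′ wRu)
      core {u} wRu (inj₂ refl)
        with to (⊨-φ M (tran , eucl) u (proj₂ (R⊆W M wRu))) (t _ refl u wRu)
      ... | k , a , r = from (⊨-⋁α δ S M u) (k , from (S⇔ k) (u , wRu , a , r) , a)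

      diamond : ∀ γ → γ ∈ Γ δ S → Satisfiable 𝒦 (B δ S ∪ ｛ ⋁α δ S ｝ ∪ ｛ γ ｝)
      diamond γ (k′ , k∈S , γ∈) with to (S⇔ k′) k∈S
      ... | u , wRu , _ , _ , diamonds with diamonds γ γ∈
      ...   | x , uRx , g = Y , M , k , x , proj₂ (R⊆W M uRx) , λ
        { ψ (inj₁ b)           → core (tran wRu uRx) (inj₁ b)
        ; ψ (inj₂ (inj₁ a))    → core (tran wRu uRx) (inj₂ a)
        ; ψ (inj₂ (inj₂ refl)) → g }

    -- The model of all valuations satisfying Core δ S makes φ true throughout.
    coherent⇒global : ∀ {𝒦 : FrameClass} → ∃[ S ] Coherent δ S 𝒦 → Global φ
    coherent⇒global {𝒦} (S , sat , sats) =
      _ , M , total-S5 X , satisfying-valuation {𝒦} (Core-propositional δ S) sat , λ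
        v v∈X → from (⊨-φ M k45 v v∈X) (disjunct v v∈X)
      where
      X : Pred (At → Bool) 0ℓ
      X v = ∀ ψ → ψ ∈ Core δ S → v ⊩ ψ

      M : Model (At → Bool)
      M = total X

      k45 : K45 (frame M)
      k45 = KD45⊑K45 (frame M) (S5⊑KD45 (frame M) (total-S5 X))

      disjunct : ∀ v → v ∈ X → ∃[ k ] (M , v ⊨ δα δ k) × Realises M (R M v) (δ k)
      disjunct v v∈X with to (⊨-⋁α δ S (total U) v) (v∈X _ (inj₂ refl))
      ... | k , k∈S , a = k , from (⊨-total v∈X (δα-propositional δ k)) a , boxes , diamonds
        where
        boxes : ∀ β → β ∈ˡ Disjunct.boxed (δ k) → ∀ u → R M v u → M , u ⊨ β
        boxes β β∈ u (_ , u∈X) =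
          from (⊨-total u∈X (boxed-propositional (δ k) β∈)) (u∈X β (inj₁ (k , k∈S , β∈)))

        diamonds : ∀ γ → γ ∈ˡ Disjunct.diamonded (δ k) → ∃[ u ] R M v u × (M , u ⊨ γ)
        diamonds γ γ∈ with satisfying-valuation {𝒦}
          (λ { (inj₁ b)           → Core-propositional δ S (inj₁ b)
             ; (inj₂ (inj₁ a))    → Core-propositional δ S (inj₂ a)
             ; (inj₂ (inj₂ refl)) → diamonded-propositional (δ k) γ∈ })
          (sats γ (k , k∈S , γ∈))
        ... | u , h = u , (v∈X , u∈X) ,
          from (⊨-total u∈X (diamonded-propositional (δ k) γ∈)) (h γ (inj₂ (inj₂ refl)))
          where
          u∈X : u ∈ X
          u∈X ψ (inj₁ b) = h ψ (inj₁ b)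
          u∈X ψ (inj₂ a) = h ψ (inj₂ (inj₁ a))

    module _ {𝒦 : FrameClass} (S5⊑𝒦 : S5 ⊑ 𝒦) (𝒦⊑KD45 : 𝒦 ⊑ KD45) where

      believable⇒global : Believable 𝒦 φ → Global φ
      believable⇒global = coherent⇒global {𝒦} ∘ believable⇒coherent 𝒦⊑KD45

      unbelievable⇔ : (¬ Global φ) ⇔ Unbelievable 𝒦 φ
      unbelievable⇔ = ¬-⇔ (mk⇔
        (knowable⇒believable φ ∘ global⇒knowable φ S5⊑𝒦)
        believable⇒global)

      unknowable⇔ : (¬ Global φ) ⇔ Unknowable 𝒦 φ
      unknowable⇔ = ¬-⇔ (mk⇔
        (global⇒knowable φ S5⊑𝒦)
        (believable⇒global ∘ knowable⇒believable φ))

      common : All ((¬ Global φ) ⇔_)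
        (Unbelievable 𝒦 φ ∷ Unknowable 𝒦 φ ∷ Valid 𝒦 (φ ↔ φ ∧ ¬ᶠ □ φ)
          ∷ DNFCondition 𝒦 δ ∷ [])
      common =
          unbelievable⇔
        ∷ unknowable⇔
        ∷ unknowable⇔valid 𝒦 φ ⇔-∘ unknowable⇔
        ∷ incoherent⇔DNFCondition δ ⇔-∘ ¬-⇔ (mk⇔
            (believable⇒coherent 𝒦⊑KD45 ∘ knowable⇒believable φ
              ∘ global⇒knowable φ S5⊑𝒦)
            (coherent⇒global {𝒦}))
        ∷ []

    -- A state at which φ remains true in all iterates comes to believe φ.
    surviving⇒believable : ∀ {Y : Set} (M : Model Y) → S5 (frame M) → ∀ w →
      (∀ m → w ∈ W (M ∣^[ m ] φ) × (M ∣^[ m ] φ , w ⊨ φ)) → Believable S5 φ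
    surviving⇒believable M s5 w survives =
      _ , stage (suc N) , s5-at (suc N) , w , proj₁ (survives (suc N)) ,
      λ { _ refl → believed }
      where
      stage : ℕ → Model _
      stage m = M ∣^[ m ] φ

      -- At stage m, the states accessible from w realise all diamonds of δ k.
      Q : Fin n → Pred ℕ 0ℓ
      Q k m = ∀ γ → γ ∈ˡ Disjunct.diamonded (δ k) →
        ∃[ u ] R (stage m) w u × (stage m , u ⊨ γ)

      Q-decreasing : ∀ k → Decreasing (Q k)
      Q-decreasing k m q γ γ∈ with q γ γ∈
      ... | u , wRu , g = u , proj₁ wRu ,
        to (⊨-∣ (stage m) φ (proj₂ (proj₂ wRu)) (diamonded-propositional (δ k) γ∈)) g

      N : ℕ
      N = proj₁ (stabilise Q Q-decreasing)

      persist : ∀ k → Q k N → Q k (suc N)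
      persist = proj₂ (stabilise Q Q-decreasing) N ≤-refl

      s5-at : ∀ m → S5 (frame (stage m))
      s5-at = ∣^-S5 M φ s5

      k45-at : ∀ m → K45 (frame (stage m))
      k45-at m = KD45⊑K45 (frame (stage m)) (S5⊑KD45 (frame (stage m)) (s5-at m))

      symm-at : ∀ m → Symmetric (R (stage m))
      symm-at m = proj₁ (proj₂ (s5-at m))

      tran-at : ∀ m → Transitive (R (stage m))
      tran-at m = proj₂ (proj₂ (s5-at m))

      -- The disjunct δ k true at u at stage N is still true at stage N + 1:
      -- its diamonds are moved from u to w, where they persist, and back.
      believed : stage (suc N) , w ⊨ □ φ
      believed u wRu@(wRu′ , _ , u∈@(u∈N , φ-at-u))
        with to (⊨-φ (stage N) (k45-at N) u u∈N) φ-at-u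
      ... | k , a , boxes , diamonds =
        from (⊨-φ (stage (suc N)) (k45-at (suc N)) u u∈)
          ( k
          , from (⊨-∣ (stage N) φ u∈ (δα-propositional δ k)) a
          , (λ β β∈ x uRx → from
              (⊨-∣ (stage N) φ (proj₂ (proj₂ uRx)) (boxed-propositional (δ k) β∈))
              (boxes β β∈ x (proj₁ uRx)))
          , λ γ γ∈ → let (x , wRx , g) = persist k atN γ γ∈ in
              x , tran-at (suc N) (symm-at (suc N) wRu) wRx , g)
        where
        atN : Q k N
        atN γ γ∈ = let (x , uRx , g) = diamonds γ γ∈ in
          x , tran-at N wRu′ uRx , g

    selfRefuting⇔ : (¬ Global φ) ⇔ EventuallySelfRefuting φ
    selfRefuting⇔ = mk⇔
      (λ ¬glob {_} M s5 w w∈ _ → dne (λ none → ¬glob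
        (believable⇒global {S5} S5⊑S5 S5⊑KD45
          (surviving⇒believable M s5 w (λ m → dne (λ ¬A → none (m , ¬A)))))))
      (selfRefuting⇒¬global φ)

theorem3 : ExcludedMiddle (lsuc 0ℓ) →
    (At : Set) (p₀ : At) → let open Modal At p₀ in
    (φ : Formula) (n : ℕ) (δ : Fin n → Disjunct) → IsDNFOf δ φ →
    TFAE ( Unbelievable KD45 φ
    ∷ Unknowable KD45 φ
    ∷ Valid KD45 (φ ↔ φ ∧ ¬ᶠ □ φ)
    ∷ DNFCondition KD45 δ
    ∷ [])
    ×
    TFAE ( Unbelievable S5 φ
    ∷ Unknowable S5 φ
    ∷ Valid S5 (φ ↔ φ ∧ ¬ᶠ □ φ)
    ∷ DNFCondition S5 δ
    ∷ AlwaysInformative φ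
    ∷ EventuallySelfRefuting φ
    ∷ [])
theorem3 em At p₀ φ n δ dnf =
    TFAE-via (common {KD45} S5⊑KD45 KD45⊑KD45)
  , TFAE-via (++⁺ (common {S5} S5⊑S5 S5⊑KD45)
      (alwaysInformative⇔ φ ∷ selfRefuting⇔ ∷ []))
  where
  open Semantics em At p₀
  open DNF φ δ dnf
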